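{- Let $S$ be a specular set on a finite alphabet $A$ and let $\mathcal{G}$ be its parity graph. For $i,j\in\{0,1\}$ let $S_{i,j}$ be the set of words in $S$ which are the label of a path from $i$ to $j$ in $\mathcal{G}$. Then: (1) The family $(S_{i,j}\setminus\{\varepsilon\})_{0\le i,j\le1}$ is a partition of $S\setminus\{\varepsilon\}$. (2) For $u\in S_{i,j}\setminus\{\varepsilon\}$ and $v\in S_{k,\ell}\setminus\{\varepsilon\}$, if $uv\in S$, then $j=k$. (3) $S_{0,0}\cup S_{1,1}$ is the set of even words of $S$. (4) $S_{i,j}^{ -1}=S_{1-j,1-i}$ for all $i,j\in\{0,1\}$.
   Context: Words are over a finite alphabet $A$; $\varepsilon$ is the empty word. A set $S$ of words on $A$ is factorial if it contains $A$ and all the factors of its elements. For $w\in S$ let $L(w)=\{a\in A\mid aw\in S\}$, $R(w)=\{a\in A\mid wa\in S\}$, $B(w)=\{(a,b)\in A\times A\mid awb\in S\}$. A factorial set $S$ is biextendable if $B(w)\neq\emptyset$ for all $w\in S$. The extension graph $\mathcal{E}(w)$ is the undirected graph whose vertex set is the disjoint union of $L(w)$ and $R(w)$, the copy of $a\in L(w)$ being denoted $1\otimes a$ and the copy of $b\in R(w)$ being denoted $b\otimes 1$, with an edge $(1\otimes a,b\otimes1)$ for each $(a,b)\in B(w)$. A biextendable set $S$ is a tree set of characteristic $c$ if $\mathcal{E}(w)$ is a tree for every nonempty $w\in S$ and $\mathcal{E}(\varepsilon)$ is a disjoint union of $c$ trees. Let $\theta$ be an involution on $A$ (possibly with fixed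 points) and let $G_\theta$ be the group generated by $A$ with relations $a\theta(a)=1$, $a\in A$ (so $a^{ -1}=\theta(a)$). A word is reduced if it has no factor $a\theta(a)$ with $a\in A$; the inverse of a reduced word $a_1\cdots a_n$ is the reduced word $\theta(a_n)\cdots\theta(a_1)$, and for a set $Y$ of reduced words $Y^{ -1}=\{y^{ -1}\mid y\in Y\}$. A laminary set on $A$ relative to $\theta$ is a biextendable set of reduced words closed under taking inverses. A specular set is a laminary set which is a tree set of characteristic $2$. Let $\mathcal{T}_0,\mathcal{T}_1$ be the two trees forming $\mathcal{E}(\varepsilon)$. The parity graph $\mathcal{G}$ of $S$ is the directed graph with vertices $0,1$ and edges all triples $(i,a,j)$ (from $i$ to $j$ with label $a$) with $a\in A$ such that $(1\otimes b,a\otimes1)\in\mathcal{T}_i$ and $(1\otimes a,c\otimes1)\in\mathcal{T}_j$ for some $b,c\in A$. For every letter $a\in A$ there is exactly one edge labeled $a$. The empty word labels the empty path from $i$ to $i$. A letter $a$ is even if its two occurrences $1\otimes a$, $a\otimes1$ as vertices of $\mathcal{E}(\varepsilon)$ are in the same tree, and odd otherwise; a word of $S$ is even if it has an even number of (occurrences of) odd letters. A partition here means a pairwise disjoint family with the given union; some members may be empty. -}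

module Defs where

open import Level using (0ℓ)
open import Data.Nat using (ℕ; _≤_)
open import Data.Nat.Divisibility using (_∣_)
open import Data.Fin using (Fin)
open import Data.Fin.Properties using () renaming (_≟_ to _≟ᶠ_)
open import Data.List using (List; []; _∷_; _++_; [_]; map; reverse; length; filter)
open import Data.List.Relation.Binary.Infix.Heterogeneous using (Infix; here; there)
open import Data.List.Relation.Binary.Prefix.Heterogeneous using (Prefix; []; _∷_)
open import Data.List.Relation.Unary.Linked using (Linked)
open import Data.List.Relation.Unary.Unique.Propositional using (Unique)
open import Data.Product using (_×_; _,_; ∃-syntax)
open import Function using (_⇔_; Equivalence)
open import Relation.Binary.Core using (Rel)
open import Relation.Binary.Construct.Closure.ReflexiveTransitive using (Star)
open import Relation.Binary.PropositionalEquality using (_≡_; _≢_; refl; trans)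
open import Relation.Nullary using (¬_; yes; no; ¬?)
open import Relation.Unary using (Pred; _∈_; _⊥_; _≐_; ⋃; Decidable; Satisfiable)

-- A simple undirected graph whose vertex set is a subset of X.

record Graph (X : Set) : Set₁ where
  field
    Vertex      : Pred X 0ℓ
    Edge        : Rel X 0ℓ
    edge-vertex : ∀ {x y} → Edge x y → Vertex x
    edge-sym    : ∀ {x y} → Edge x y → Edge y x
    edge-irrefl : ∀ {x} → ¬ Edge x x

open Graph public

module _ {X : Set} where

  Connected : Graph X → Set
  Connected G = ∀ {x y} → Vertex G x → Vertex G y → Star (Edge G) x y

  -- The cycle x, xs, x; it visits at least three distinct vertices.
  record IsCycle (G : Graph X) (x : X) (xs : List X) : Set where
    field
      closed-walk : Linked (Edge G) (x ∷ xs ++ [ x ])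
      distinct    : Unique (x ∷ xs)
      long        : 2 ≤ length xs

  Acyclic : Graph X → Set
  Acyclic G = ∀ x xs → ¬ IsCycle G x xs

  record IsTree (G : Graph X) : Set where
    field
      nonempty  : Satisfiable (Vertex G)
      connected : Connected G
      acyclic   : Acyclic G

  record IsDisjointUnion {c : ℕ} (G : Graph X) (T : Fin c → Graph X) : Set where
    field
      vertices : ∀ x → Vertex G x ⇔ (∃[ i ] Vertex (T i) x)
      edges    : ∀ x y → Edge G x y ⇔ (∃[ i ] Edge (T i) x y)
      disjoint : ∀ {i j x} → Vertex (T i) x → Vertex (T j) x → i ≡ j

  -- An expression of G as a disjoint union of c trees, numbered by Fin c.
  record TreeDecomposition (G : Graph X) (c : ℕ) : Set₁ where
    field
      tree            : Fin c → Graph X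
      isTree          : ∀ i → IsTree (tree i)
      isDisjointUnion : IsDisjointUnion G tree

open TreeDecomposition public

IsPartition : ∀ {I X : Set} → (I → Pred X 0ℓ) → Pred X 0ℓ → Set
IsPartition {I} F P = (∀ {p q} → p ≢ q → F p ⊥ F q) × (⋃ I F ≐ P)

module _ {A : Set} where

  Factor : Rel (List A) 0ℓ
  Factor = Infix _≡_

  record IsFactorial (S : Pred (List A) 0ℓ) : Set where
    field
      letters : ∀ a → [ a ] ∈ S
      factors : ∀ {u w} → Factor u w → w ∈ S → u ∈ S

  module _ (S : Pred (List A) 0ℓ) where

    L : List A → Pred A 0ℓ
    L w a = a ∷ w ∈ S

    R : List A → Pred A 0ℓ
    R w a = w ++ [ a ] ∈ S

    B : List A → Pred (A × A) 0ℓ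
    B w (a , b) = a ∷ w ++ [ b ] ∈ S

    record IsBiextendable : Set where
      field
        isFactorial : IsFactorial S
        extendable  : ∀ {w} → w ∈ S → Satisfiable (B w)

-- The letters of the left copy of A are written 1⊗ a, those of the right
-- copy a ⊗1.

infix 9 1⊗_ _⊗1

data Occurrence (A : Set) : Set where
  1⊗_ : A → Occurrence A
  _⊗1 : A → Occurrence A

module _ {A : Set} (S : Pred (List A) 0ℓ) where

  data ExtVertex (w : List A) : Pred (Occurrence A) 0ℓ where
    left  : ∀ {a} → a ∈ L S w → ExtVertex w (1⊗ a)
    right : ∀ {b} → b ∈ R S w → ExtVertex w (b ⊗1)

  data ExtEdge (w : List A) : Rel (Occurrence A) 0ℓ where
    left-right : ∀ {a b} → (a , b) ∈ B S w → ExtEdge w (1⊗ a) (b ⊗1)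
    right-left : ∀ {a b} → (a , b) ∈ B S w → ExtEdge w (b ⊗1) (1⊗ a)

module _ {A : Set} {S : Pred (List A) 0ℓ} (factorial : IsFactorial S) where

  private
    open IsFactorial factorial

    prefix-++ : ∀ w v → Prefix {A = A} _≡_ w (w ++ v)
    prefix-++ []      v = []
    prefix-++ (a ∷ w) v = refl ∷ prefix-++ w v

    prefix-refl : (w : List A) → Prefix {A = A} _≡_ w w
    prefix-refl []      = []
    prefix-refl (a ∷ w) = refl ∷ prefix-refl w

    edge⇒vertex : ∀ w {x y} → ExtEdge S w x y → ExtVertex S w x
    edge⇒vertex w (left-right {a} {b} p) =
      left (factors (here (prefix-++ (a ∷ w) [ b ])) p)
    edge⇒vertex w (right-left {a} {b} p) =
      right (factors (there (here (prefix-refl (w ++ [ b ])))) p)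

    sym-edge : ∀ {w x y} → ExtEdge S w x y → ExtEdge S w y x
    sym-edge (left-right p) = right-left p
    sym-edge (right-left p) = left-right p

  extensionGraph : List A → Graph (Occurrence A)
  extensionGraph w = record
    { Vertex      = ExtVertex S w
    ; Edge        = ExtEdge S w
    ; edge-vertex = edge⇒vertex w
    ; edge-sym    = sym-edge
    ; edge-irrefl = λ ()
    }

record IsTreeSet {A : Set} (S : Pred (List A) 0ℓ) (c : ℕ) : Set₁ where
  field
    isBiextendable : IsBiextendable S
  open IsBiextendable isBiextendable public
  field
    nonempty-word : ∀ {w} → w ∈ S → w ≢ [] → IsTree (extensionGraph isFactorial w)
    empty-word    : TreeDecomposition (extensionGraph isFactorial []) c

module _ {A : Set} (θ : A → A) where

  Reduced : Pred (List A) 0ℓ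
  Reduced w = ∀ a → ¬ Factor (a ∷ θ a ∷ []) w

  inverse : List A → List A
  inverse w = reverse (map θ w)

  inverseSet : Pred (List A) 0ℓ → Pred (List A) 0ℓ
  inverseSet Y w = ∃[ y ] y ∈ Y × w ≡ inverse y

  record IsLaminary (S : Pred (List A) 0ℓ) : Set where
    field
      isBiextendable : IsBiextendable S
      reduced        : ∀ {w} → w ∈ S → Reduced w
      inverse-closed : ∀ {w} → w ∈ S → inverse w ∈ S

  record IsSpecular (S : Pred (List A) 0ℓ) : Set₁ where
    field
      isLaminary : IsLaminary S
      isTreeSet  : IsTreeSet S 2
    open IsLaminary isLaminary public using (reduced; inverse-closed)
    open IsTreeSet isTreeSet public

-- T lists the trees T₀, T₁ that make up the extension graph of the empty word.

module _ {A : Set} {S : Pred (List A) 0ℓ} {factorial : IsFactorial S}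
         (T : TreeDecomposition (extensionGraph factorial []) 2) where

  ParityEdge : Fin 2 → A → Fin 2 → Set
  ParityEdge i a j = (∃[ b ] Edge (tree T i) (1⊗ b) (a ⊗1))
                   × (∃[ c ] Edge (tree T j) (1⊗ a) (c ⊗1))

  data Path : Fin 2 → List A → Fin 2 → Set where
    []  : ∀ {i} → Path i [] i
    _∷_ : ∀ {i j k a w} → ParityEdge i a j → Path j w k → Path i (a ∷ w) k

  -- The set S_{i,j}.
  pathLabels : Fin 2 → Fin 2 → Pred (List A) 0ℓ
  pathLabels i j w = w ∈ S × Path i w j

  EvenLetter : Pred A 0ℓ
  EvenLetter a = ∃[ i ] Vertex (tree T i) (1⊗ a) × Vertex (tree T i) (a ⊗1)

  private
    open IsDisjointUnion (isDisjointUnion T)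
    open IsFactorial factorial using (letters)

    leftTree : ∀ a → ∃[ i ] Vertex (tree T i) (1⊗ a)
    leftTree a = Equivalence.to (vertices (1⊗ a)) (left (letters a))

    rightTree : ∀ a → ∃[ i ] Vertex (tree T i) (a ⊗1)
    rightTree a = Equivalence.to (vertices (a ⊗1)) (right (letters a))

  evenLetter? : Decidable EvenLetter
  evenLetter? a with leftTree a | rightTree a
  ... | i , l | j , r with i ≟ᶠ j
  ...   | yes refl = yes (i , l , r)
  ...   | no  i≢j  =
    no λ (k , l′ , r′) → i≢j (trans (disjoint l l′) (disjoint r′ r))

  oddLetters : List A → List A
  oddLetters = filter (λ a → ¬? (evenLetter? a))

  evenWords : Pred (List A) 0ℓ
  evenWords w = w ∈ S × 2 ∣ length (oddLetters w)

{-# OPTIONS --safe #-}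

-- The map 1⊗a ↦ θ(a)⊗1, b⊗1 ↦ 1⊗θ(b) is an involutive automorphism of the
-- extension graph of the empty word.  It fixes no vertex, and it flips no edge
-- because words aθ(a) are not reduced.  An acyclic graph with such an
-- automorphism φ contains no walk from x to φ x: a shortest such walk, over all
-- x, followed by its image under φ would be a cycle.  Hence φ exchanges the two
-- trees, which is (4) on letters.  For (1)–(3), the label a determines the
-- edge of the parity graph: it starts at the tree of a⊗1 and ends at the tree
-- of 1⊗a; and for ab ∈ S the edge (1⊗a, b⊗1) puts both occurrences in one tree.

module Submission where

open import Defs
open import Level using (0ℓ)
open import Algebra.Definitions using (Involutive)
open import Data.Nat using (ℕ; suc; _<_; z≤n; s≤s)
open import Data.Nat.Divisibility using (_∣_; _∣0; _∣?_; ∣m+n∣m⇒∣n; ∣m∣n⇒∣m+n; ∣-refl)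
open import Data.Nat.Induction using (<-wellFounded)
open import Data.Nat.Properties using (≤-trans; ≤-reflexive; ≤-pred; +-comm)
open import Data.Fin using (Fin; opposite)
open import Data.Fin.Patterns using (0F; 1F)
open import Data.Fin.Properties using (opposite-involutive) renaming (_≟_ to _≟ᶠ_)
open import Data.List using (List; []; _∷_; _++_; [_]; map; reverse; length)
open import Data.List.Membership.Propositional using () renaming (_∈_ to _∈ˡ_)
open import Data.List.Membership.Propositional.Properties using (∈-∃++; ∈-map⁻)
open import Data.List.Properties
  using (∷-injective; ++-assoc; length-++-≤ˡ; length-++-≤ʳ; length-++-sucʳ; map-++; map-∘; map-id;
         map-cong; unfold-reverse; reverse-map; reverse-involutive)
open import Data.List.Relation.Binary.Infix.Heterogeneous using (here; there)
open import Data.List.Relation.Binary.Infix.Heterogeneous.Properties using (fromPointwise)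
open import Data.List.Relation.Binary.Pointwise using () renaming (refl to Pointwise-refl)
open import Data.List.Relation.Binary.Prefix.Heterogeneous using ([]; _∷_)
open import Data.List.Relation.Unary.All using () renaming (tabulate to All-tabulate)
open import Data.List.Relation.Unary.AllPairs using ([]; _∷_)
open import Data.List.Relation.Unary.Any using (here; there)
open import Data.List.Relation.Unary.Linked using (Linked; []; [-]; _∷_) renaming (map to Linked-map)
open import Data.List.Relation.Unary.Linked.Properties using () renaming (map⁺ to Linked-map⁺)
open import Data.List.Relation.Unary.Unique.Propositional using (Unique)
open import Data.List.Relation.Unary.Unique.Propositional.Properties
  using () renaming (map⁺ to Unique-map⁺; ++⁺ to Unique-++⁺)
open import Data.Product using (_×_; _,_; proj₁; proj₂; ∃-syntax)
open import Data.Sum using (_⊎_; inj₁; inj₂)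
open import Function using (_↔_; _∘_; Equivalence)
open import Induction.WellFounded using (Acc; acc)
open import Relation.Binary.Construct.Closure.ReflexiveTransitive
  using (Star; ε; _◅_) renaming (map to Star-map)
open import Relation.Binary.Core using (Rel)
open import Relation.Binary.PropositionalEquality
  using (_≡_; _≢_; refl; sym; trans; cong; subst; subst₂; module ≡-Reasoning)
open import Relation.Nullary using (¬_; yes; no; contradiction)
open import Relation.Nullary.Decidable using (from-no)
open import Relation.Unary using (Pred; _∈_; _∪_; _∖_; _≐_; _⊥_; ｛_｝)

module _ {X : Set} where

  length-prefix-< : ∀ (q : List X) {z r} → length q < length (q ++ z ∷ r)
  length-prefix-< q {z} {r} =
    ≤-trans (s≤s (length-++-≤ˡ q)) (≤-reflexive (sym (length-++-sucʳ q z r)))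

  length-drop-< : ∀ p {y} (q : List X) {r} → length (p ++ r) < length (p ++ y ∷ q ++ r)
  length-drop-< []      q = s≤s (length-++-≤ʳ _ {q})
  length-drop-< (_ ∷ p) q = s≤s (length-drop-< p q)

  noRepetition⇒unique : ∀ {l : List X} → (∀ p y q r → l ≢ p ++ y ∷ q ++ y ∷ r) → Unique l
  noRepetition⇒unique {[]}    _ = []
  noRepetition⇒unique {x ∷ l} h =
    All-tabulate (λ y∈l x≡y → let q , r , eq = ∈-∃++ y∈l in
      h [] x q r (cong (x ∷_) (subst (λ y → l ≡ q ++ y ∷ r) (sym x≡y) eq)))
    ∷ noRepetition⇒unique (λ p y q r eq → h (x ∷ p) y q r (cong (x ∷_) eq))

  InOrder : X → X → List X → Set
  InOrder y z l = ∃[ p ] ∃[ q ] ∃[ r ] l ≡ p ++ y ∷ q ++ z ∷ r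

  inOrder-∷ : ∀ {x y z l} → InOrder y z l → InOrder y z (x ∷ l)
  inOrder-∷ (p , q , r , eq) = _ ∷ p , q , r , cong (_ ∷_) eq

  inOrder-compare : ∀ {y z l} → y ∈ˡ l → z ∈ˡ l → y ≡ z ⊎ InOrder y z l ⊎ InOrder z y l
  inOrder-compare (here refl) (here refl) = inj₁ refl
  inOrder-compare (here refl) (there z∈l) with ∈-∃++ z∈l
  ... | q , r , eq = inj₂ (inj₁ ([] , q , r , cong (_ ∷_) eq))
  inOrder-compare (there y∈l) (here refl) with ∈-∃++ y∈l
  ... | q , r , eq = inj₂ (inj₂ ([] , q , r , cong (_ ∷_) eq))
  inOrder-compare (there y∈l) (there z∈l) with inOrder-compare y∈l z∈l
  ... | inj₁ y≡z      = inj₁ y≡z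
  ... | inj₂ (inj₁ o) = inj₂ (inj₁ (inOrder-∷ o))
  ... | inj₂ (inj₂ o) = inj₂ (inj₂ (inOrder-∷ o))

  module _ {E : Rel X 0ℓ} where

    linked-dropʳ : ∀ q {z r} → Linked E (q ++ z ∷ r) → Linked E (q ++ [ z ])
    linked-dropʳ []          _        = [-]
    linked-dropʳ (_ ∷ [])    (e ∷ es) = e ∷ linked-dropʳ [] es
    linked-dropʳ (_ ∷ _ ∷ q) (e ∷ es) = e ∷ linked-dropʳ (_ ∷ q) es

    linked-dropˡ : ∀ p {r} → Linked E (p ++ r) → Linked E r
    linked-dropˡ []          es       = es
    linked-dropˡ (_ ∷ [])    [-]      = []
    linked-dropˡ (_ ∷ [])    (_ ∷ es) = es
    linked-dropˡ (_ ∷ _ ∷ p) (_ ∷ es) = linked-dropˡ (_ ∷ p) es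

    linked-glue : ∀ q {z r} → Linked E (q ++ [ z ]) → Linked E (z ∷ r) → Linked E (q ++ z ∷ r)
    linked-glue []          _        fs = fs
    linked-glue (_ ∷ [])    (e ∷ _)  fs = e ∷ fs
    linked-glue (_ ∷ _ ∷ q) (e ∷ es) fs = e ∷ linked-glue (_ ∷ q) es fs

    linked-removeLoop : ∀ p {y} q {r} → Linked E (p ++ y ∷ q ++ y ∷ r) → Linked E (p ++ y ∷ r)
    linked-removeLoop p q es =
      linked-glue p (linked-dropʳ p es) (linked-dropˡ (_ ∷ q) (linked-dropˡ p es))

    star⇒walk : ∀ {x y} → Star E x y → x ≡ y ⊎ (∃[ xs ] Linked E (x ∷ xs ++ [ y ]))
    star⇒walk ε = inj₁ refl
    star⇒walk (e ◅ es) with star⇒walk es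
    ... | inj₁ refl      = inj₂ ([] , e ∷ [-])
    ... | inj₂ (xs , fs) = inj₂ (_ ∷ xs , e ∷ fs)

involutive⇒injective : ∀ {X : Set} {f : X → X} → Involutive _≡_ f → ∀ {x y} → f x ≡ f y → x ≡ y
involutive⇒injective {f = f} inv {x} {y} eq = trans (sym (inv x)) (trans (cong f eq) (inv y))

module _ {X : Set} (G : Graph X) (acyclic : Acyclic G)
         (φ : X → X) (φ-involutive : Involutive _≡_ φ)
         (φ-edge : ∀ {x y} → Edge G x y → Edge G (φ x) (φ y))
         (φ-noFixedVertex : ∀ {x} → φ x ≢ x)
         (φ-noFlippedEdge : ∀ {x} → ¬ Edge G x (φ x)) where

  private

    Walk : X → List X → X → Set
    Walk x xs y = Linked (Edge G) (x ∷ xs ++ [ y ])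

    noWalkToImage : ∀ x xs → Acc _<_ (length xs) → ¬ Walk x xs (φ x)
    noWalkToImage x []          _         (e ∷ _) = φ-noFlippedEdge e
    noWalkToImage x xs@(_ ∷ ys) (acc rec) walk    = acyclic x (xs ++ map φ (x ∷ xs)) record
      { closed-walk = subst (Linked (Edge G)) (sym (++-assoc (x ∷ xs) (map φ (x ∷ xs)) [ x ]))
                        (linked-glue (x ∷ xs) walk φ-walk)
      ; distinct    = Unique-++⁺ l-unique
                        (Unique-map⁺ (involutive⇒injective φ-involutive) l-unique) l-disjoint
      ; long        = s≤s (≤-trans (s≤s z≤n) (length-++-≤ʳ (map φ (x ∷ xs)) {ys}))
      }
      where
      φ-walk : Linked (Edge G) (map φ (x ∷ xs) ++ [ x ])
      φ-walk = subst (Linked (Edge G))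
        (trans (map-++ φ (x ∷ xs) [ φ x ]) (cong (λ y → map φ (x ∷ xs) ++ [ y ]) (φ-involutive x)))
        (Linked-map⁺ (Linked-map φ-edge walk))

      walkAt : ∀ p {y} q {z r} → x ∷ xs ≡ p ++ y ∷ q ++ z ∷ r →
               Linked (Edge G) (p ++ y ∷ q ++ z ∷ r ++ [ φ x ])
      walkAt p q eq = subst (Linked (Edge G))
        (trans (cong (_++ [ φ x ]) eq)
          (trans (++-assoc p _ _) (cong (λ l → p ++ _ ∷ l) (++-assoc q _ _))))
        walk

      noLoop : ∀ p y q r → x ∷ xs ≢ p ++ y ∷ q ++ y ∷ r
      noLoop [] y q r eq with ∷-injective eq
      ... | refl , xs≡ = noWalkToImage x r
        (rec (subst (λ l → length r < length l) (sym xs≡) (length-++-≤ʳ (x ∷ r) {q})))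
        (linked-removeLoop [] q (walkAt [] q eq))
      noLoop (_ ∷ p) y q r eq with ∷-injective eq
      ... | refl , xs≡ = noWalkToImage x (p ++ y ∷ r)
        (rec (subst (λ l → length (p ++ y ∷ r) < length l) (sym xs≡) (length-drop-< p q)))
        (subst (λ l → Linked (Edge G) (x ∷ l)) (sym (++-assoc p _ _))
          (linked-removeLoop (x ∷ p) q (walkAt (x ∷ p) q eq)))

      l-unique : Unique (x ∷ xs)
      l-unique = noRepetition⇒unique noLoop

      noSegment : ∀ {y z} → InOrder y z (x ∷ xs) → z ≢ φ y
      noSegment {y} (p , q , r , eq) refl =
        noWalkToImage y q (rec (≤-pred q<)) (linked-dropʳ (y ∷ q) (linked-dropˡ p (walkAt p q eq)))
        where
        q< : length (y ∷ q) < length (x ∷ xs)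
        q< = ≤-trans (length-prefix-< (y ∷ q))
               (≤-trans (length-++-≤ʳ _ {p}) (≤-reflexive (sym (cong length eq))))

      l-disjoint : ∀ {z} → ¬ (z ∈ˡ x ∷ xs × z ∈ˡ map φ (x ∷ xs))
      l-disjoint (z∈l , z∈φl) with ∈-map⁻ φ z∈φl
      ... | y , y∈l , z≡φy with inOrder-compare y∈l z∈l
      ... | inj₁ y≡z      = φ-noFixedVertex (trans (sym z≡φy) (sym y≡z))
      ... | inj₂ (inj₁ o) = noSegment o z≡φy
      ... | inj₂ (inj₂ o) = noSegment o (trans (sym (φ-involutive y)) (cong φ (sym z≡φy)))

  noStarToImage : ∀ {x} → ¬ Star (Edge G) x (φ x)
  noStarToImage s with star⇒walk s
  ... | inj₁ x≡φx        = φ-noFixedVertex (sym x≡φx)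
  ... | inj₂ (xs , walk) = noWalkToImage _ xs (<-wellFounded _) walk

module _ {X : Set} {c : ℕ} {G : Graph X} (T : TreeDecomposition G c) where

  open IsDisjointUnion (isDisjointUnion T)

  vertexIn⇒edgeIn : ∀ {i x y} → Vertex (tree T i) x → Edge G x y → Edge (tree T i) x y
  vertexIn⇒edgeIn {x = x} {y} x∈i e with Equivalence.to (edges x y) e
  ... | j , e′ with disjoint x∈i (edge-vertex (tree T j) e′)
  ... | refl = e′

  edgeIn⇒edge : ∀ {i x y} → Edge (tree T i) x y → Edge G x y
  edgeIn⇒edge {i} {x} {y} e = Equivalence.from (edges x y) (i , e)

  edgeTarget : ∀ {i x y} → Edge (tree T i) x y → Vertex (tree T i) y
  edgeTarget {i} e = edge-vertex (tree T i) (edge-sym (tree T i) e)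

  treeOf : ∀ {x} → Vertex G x → ∃[ i ] Vertex (tree T i) x
  treeOf {x} = Equivalence.to (vertices x)

  linkedIn : ∀ {i x xs} → Vertex (tree T i) x →
             Linked (Edge G) (x ∷ xs) → Linked (Edge (tree T i)) (x ∷ xs)
  linkedIn x∈i [-]      = [-]
  linkedIn x∈i (e ∷ es) = let e′ = vertexIn⇒edgeIn x∈i e in e′ ∷ linkedIn (edgeTarget e′) es

  cycleStart : ∀ {x xs} → IsCycle G x xs → Vertex G x
  cycleStart {xs = []}    record { closed-walk = e ∷ _ } = edge-vertex G e
  cycleStart {xs = _ ∷ _} record { closed-walk = e ∷ _ } = edge-vertex G e

  union-acyclic : Acyclic G
  union-acyclic x xs cycle = let i , x∈i = treeOf (cycleStart cycle) in
    IsTree.acyclic (isTree T i) x xs record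
      { closed-walk = linkedIn x∈i (IsCycle.closed-walk cycle)
      ; distinct    = IsCycle.distinct cycle
      ; long        = IsCycle.long cycle
      }

fin2-opposite : ∀ {i j : Fin 2} → i ≢ j → j ≡ opposite i
fin2-opposite {0F} {0F} i≢j = contradiction refl i≢j
fin2-opposite {0F} {1F} _   = refl
fin2-opposite {1F} {0F} _   = refl
fin2-opposite {1F} {1F} i≢j = contradiction refl i≢j

module _ {A : Set} {S : Pred (List A) 0ℓ} (biextendable : IsBiextendable S)
         (T : TreeDecomposition (extensionGraph (IsBiextendable.isFactorial biextendable) []) 2) where

  open IsBiextendable biextendable
  open IsFactorial isFactorial
  open IsDisjointUnion (isDisjointUnion T) using (disjoint)

  parityEdge⇒vertices : ∀ {i a j} → ParityEdge T i a j →
                        Vertex (tree T i) (a ⊗1) × Vertex (tree T j) (1⊗ a)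
  parityEdge⇒vertices {j = j} ((_ , e) , (_ , f)) = edgeTarget T e , edge-vertex (tree T j) f

  vertices⇒parityEdge : ∀ {i a j} → Vertex (tree T i) (a ⊗1) → Vertex (tree T j) (1⊗ a) →
                        ParityEdge T i a j
  vertices⇒parityEdge {i} {a} r l with extendable (letters a)
  ... | (b , c) , bac∈S =
      (b , edge-sym (tree T i) (vertexIn⇒edgeIn T r
             (right-left (factors (here (refl ∷ refl ∷ [])) bac∈S))))
    , (c , vertexIn⇒edgeIn T l
             (left-right (factors (there (here (refl ∷ refl ∷ []))) bac∈S)))

  parityEdge-unique : ∀ {i i′ a j j′} → ParityEdge T i a j → ParityEdge T i′ a j′ →
                      i ≡ i′ × j ≡ j′
  parityEdge-unique e f with parityEdge⇒vertices e | parityEdge⇒vertices f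
  ... | r , l | r′ , l′ = disjoint r r′ , disjoint l l′

  path-unique : ∀ {i i′ a w j j′} → Path T i (a ∷ w) j → Path T i′ (a ∷ w) j′ →
                i ≡ i′ × j ≡ j′
  path-unique (e ∷ []) (f ∷ []) = parityEdge-unique e f
  path-unique (e ∷ p@(_ ∷ _)) (f ∷ q@(_ ∷ _)) =
    proj₁ (parityEdge-unique e f) , proj₂ (path-unique p q)

  path-exists : ∀ a w → a ∷ w ∈ S → ∃[ i ] ∃[ j ] Path T i (a ∷ w) j
  path-exists a [] _ =
    let i , r = treeOf T (right (letters a))
        j , l = treeOf T (left (letters a))
    in i , j , vertices⇒parityEdge r l ∷ []
  path-exists a (b ∷ w) abw∈S
    with path-exists b w (factors (there (fromPointwise (Pointwise-refl refl))) abw∈S)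
  ... | k , j , p@(e ∷ _) =
    let i , r = treeOf T (right (letters a))
        l     = edgeTarget T (vertexIn⇒edgeIn T (proj₁ (parityEdge⇒vertices e))
                  (right-left (factors (here (refl ∷ refl ∷ [])) abw∈S)))
    in i , j , vertices⇒parityEdge r l ∷ p

  path-split : ∀ {i j} u {v} → Path T i (u ++ v) j → ∃[ k ] Path T i u k × Path T k v j
  path-split []      p       = _ , [] , p
  path-split (_ ∷ u) (e ∷ p) = let k , q , r = path-split u p in k , e ∷ q , r

  path-∷ʳ : ∀ {i j k a u} → Path T i u j → ParityEdge T j a k → Path T i (u ++ [ a ]) k
  path-∷ʳ []      f = f ∷ []
  path-∷ʳ (e ∷ p) f = e ∷ path-∷ʳ p f

  path-parity : ∀ {i w j} → Path T i w j →
                (i ≡ j → 2 ∣ length (oddLetters T w)) × (i ≢ j → 2 ∣ suc (length (oddLetters T w)))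
  path-parity [] = (λ _ → 2 ∣0) , contradiction refl
  path-parity (_∷_ {i} {j} {k} {a} e p)
    with parityEdge⇒vertices e | path-parity p | evenLetter? T a
  ... | r , l | same , diff | yes (_ , l′ , r′) with disjoint r r′ | disjoint l l′
  ...   | refl | refl = same , diff
  path-parity (_∷_ {i} {j} {k} {a} e p)
      | r , l | same , diff | no odd =
      (λ { refl → diff j≢i })
    , (λ i≢k → ∣m∣n⇒∣m+n ∣-refl (same (trans (fin2-opposite i≢j) (sym (fin2-opposite i≢k)))))
    where
    i≢j : i ≢ j
    i≢j refl = odd (i , l , r)
    j≢i : j ≢ i
    j≢i = i≢j ∘ sym

  even⇒closed : ∀ {i w j} → Path T i w j → 2 ∣ length (oddLetters T w) → i ≡ j
  even⇒closed {i} {w} {j} p 2∣n with i ≟ᶠ j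
  ... | yes i≡j = i≡j
  ... | no  i≢j = contradiction
    (∣m+n∣m⇒∣n (subst (2 ∣_) (+-comm 1 _) (proj₂ (path-parity p) i≢j)) 2∣n)
    (from-no (2 ∣? 1))

  pathLabels-partition : IsPartition (λ ((i , j) : Fin 2 × Fin 2) → pathLabels T i j ∖ ｛ [] ｝)
                                     (S ∖ ｛ [] ｝)
  pathLabels-partition = disjointLabels , (λ { (_ , (w∈S , _) , w≢[]) → w∈S , w≢[] }) , cover
    where
    disjointLabels : ∀ {p q : Fin 2 × Fin 2} → p ≢ q →
                     (pathLabels T (proj₁ p) (proj₂ p) ∖ ｛ [] ｝)
                       ⊥ (pathLabels T (proj₁ q) (proj₂ q) ∖ ｛ [] ｝)
    disjointLabels p≢q {[]}    ((_ , w≢[]) , _)            = w≢[] refl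
    disjointLabels p≢q {_ ∷ _} (((_ , p) , _) , (_ , q) , _) with path-unique p q
    ... | refl , refl = p≢q refl

    cover : ∀ {w} → w ∈ S ∖ ｛ [] ｝ → ∃[ p ] w ∈ pathLabels T (proj₁ p) (proj₂ p) ∖ ｛ [] ｝
    cover {[]}    (_ , w≢[])   = contradiction refl w≢[]
    cover {a ∷ w} (w∈S , w≢[]) = let i , j , p = path-exists a w w∈S in
      (i , j) , (w∈S , p) , w≢[]

  pathLabels-composable : ∀ i j k l u v → u ∈ pathLabels T i j ∖ ｛ [] ｝ →
                          v ∈ pathLabels T k l ∖ ｛ [] ｝ → u ++ v ∈ S → j ≡ k
  pathLabels-composable i j k l []      v       (_ , u≢[])    _             _ =
    contradiction refl u≢[]
  pathLabels-composable i j k l (_ ∷ _) []      _             (_ , v≢[])    _ =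
    contradiction refl v≢[]
  pathLabels-composable i j k l (a ∷ u) (b ∷ v) ((_ , p) , _) ((_ , q) , _) uv∈S =
    let _ , _ , r       = path-exists a (u ++ b ∷ v) uv∈S
        _ , p′ , q′     = path-split (a ∷ u) r
    in trans (proj₂ (path-unique p p′)) (proj₁ (path-unique q′ q))

  closedLabels≐evenWords : pathLabels T 0F 0F ∪ pathLabels T 1F 1F ≐ evenWords T
  closedLabels≐evenWords = (λ { (inj₁ (w∈S , p)) → w∈S , proj₁ (path-parity p) refl
                              ; (inj₂ (w∈S , p)) → w∈S , proj₁ (path-parity p) refl }) , even⇒label
    where
    even⇒label : ∀ {w} → w ∈ evenWords T → w ∈ pathLabels T 0F 0F ∪ pathLabels T 1F 1F
    even⇒label {[]}    (w∈S , _)   = inj₁ (w∈S , [])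
    even⇒label {a ∷ w} (w∈S , 2∣n) with path-exists a w w∈S
    ... | i , j , p with even⇒closed p 2∣n
    even⇒label {a ∷ w} (w∈S , 2∣n) | 0F , _ , p | refl = inj₁ (w∈S , p)
    even⇒label {a ∷ w} (w∈S , 2∣n) | 1F , _ , p | refl = inj₂ (w∈S , p)

module _ {A : Set} (θ : A → A) (θ-involutive : Involutive _≡_ θ) where

  inverse-involutive : Involutive _≡_ (inverse θ)
  inverse-involutive w = begin
    reverse (map θ (reverse (map θ w)))  ≡⟨ cong reverse (reverse-map θ (map θ w)) ⟩
    reverse (reverse (map θ (map θ w)))  ≡⟨ reverse-involutive _ ⟩
    map θ (map θ w)                      ≡⟨ map-∘ w ⟨
    map (θ ∘ θ) w                        ≡⟨ map-cong θ-involutive w ⟩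
    map (λ a → a) w                      ≡⟨ map-id w ⟩
    w                                    ∎
    where open ≡-Reasoning

  mirror : Occurrence A → Occurrence A
  mirror (1⊗ a) = θ a ⊗1
  mirror (a ⊗1) = 1⊗ θ a

  mirror-involutive : Involutive _≡_ mirror
  mirror-involutive (1⊗ a) = cong 1⊗_ (θ-involutive a)
  mirror-involutive (a ⊗1) = cong _⊗1 (θ-involutive a)

  mirror-noFixedVertex : ∀ {x} → mirror x ≢ x
  mirror-noFixedVertex {1⊗ _} ()
  mirror-noFixedVertex {_ ⊗1} ()

  module _ (S : Pred (List A) 0ℓ) (specular : IsSpecular θ S)
           (T : TreeDecomposition (extensionGraph (IsSpecular.isFactorial specular) []) 2) where

    open IsSpecular specular

    private
      G : Graph (Occurrence A)
      G = extensionGraph isFactorial []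

    mirror-edge : ∀ {x y} → Edge G x y → Edge G (mirror x) (mirror y)
    mirror-edge (left-right ab∈S) = right-left (inverse-closed ab∈S)
    mirror-edge (right-left ab∈S) = left-right (inverse-closed ab∈S)

    mirror-noFlippedEdge : ∀ {x} → ¬ Edge G x (mirror x)
    mirror-noFlippedEdge {1⊗ a} (left-right aθa∈S) =
      reduced aθa∈S a (here (refl ∷ refl ∷ []))
    mirror-noFlippedEdge {a ⊗1} (right-left θaa∈S) =
      reduced θaa∈S (θ a) (here (refl ∷ θ-involutive a ∷ []))

    mirror-tree : ∀ {i x} → Vertex (tree T i) x → Vertex G (mirror x) →
                  Vertex (tree T (opposite i)) (mirror x)
    mirror-tree {i} {x} x∈i mx with treeOf T mx
    ... | j , mx∈j = subst (λ k → Vertex (tree T k) (mirror x)) (fin2-opposite i≢j) mx∈j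
      where
      i≢j : i ≢ j
      i≢j refl = noStarToImage G (union-acyclic T) mirror mirror-involutive mirror-edge
        mirror-noFixedVertex mirror-noFlippedEdge
        (Star-map (edgeIn⇒edge T) (IsTree.connected (isTree T i) x∈i mx∈j))

    mirror-parityEdge : ∀ {i a j} → ParityEdge T i a j → ParityEdge T (opposite j) (θ a) (opposite i)
    mirror-parityEdge {a = a} e with parityEdge⇒vertices isBiextendable T e
    ... | r , l = vertices⇒parityEdge isBiextendable T
      (mirror-tree l (right (IsFactorial.letters isFactorial (θ a))))
      (mirror-tree r (left (IsFactorial.letters isFactorial (θ a))))

    inverse-path : ∀ {i w j} → Path T i w j → Path T (opposite j) (inverse θ w) (opposite i)
    inverse-path []                  = []
    inverse-path (_∷_ {a = a} {w} e p) =
      subst (λ u → Path T _ u _) (sym (unfold-reverse (θ a) (map θ w)))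
        (path-∷ʳ isBiextendable T (inverse-path p) (mirror-parityEdge e))

    inverse-pathLabels : ∀ {i j w} → w ∈ pathLabels T i j →
                         inverse θ w ∈ pathLabels T (opposite j) (opposite i)
    inverse-pathLabels (w∈S , p) = inverse-closed w∈S , inverse-path p

    inverseSet-pathLabels : ∀ i j → inverseSet θ (pathLabels T i j) ≐
                                    pathLabels T (opposite j) (opposite i)
    inverseSet-pathLabels i j =
        (λ { (_ , w∈ , refl) → inverse-pathLabels w∈ })
      , (λ {w} w∈ → inverse θ w
           , subst₂ (λ k l → inverse θ w ∈ pathLabels T k l)
               (opposite-involutive i) (opposite-involutive j) (inverse-pathLabels w∈)
           , sym (inverse-involutive w))

proposition4p11 : {A : Set} (n : ℕ) → A ↔ Fin n →
    (θ : A → A) → Involutive _≡_ θ →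
    (S : Pred (List A) 0ℓ) (specular : IsSpecular θ S) →
    (T : TreeDecomposition (extensionGraph (IsSpecular.isFactorial specular) []) 2) →
    IsPartition (λ ((i , j) : Fin 2 × Fin 2) → pathLabels T i j ∖ ｛ [] ｝) (S ∖ ｛ [] ｝)
    × (∀ i j k l u v → u ∈ pathLabels T i j ∖ ｛ [] ｝ → v ∈ pathLabels T k l ∖ ｛ [] ｝ →
    u ++ v ∈ S → j ≡ k)
    × (pathLabels T 0F 0F ∪ pathLabels T 1F 1F ≐ evenWords T)
    × (∀ i j → inverseSet θ (pathLabels T i j) ≐ pathLabels T (opposite j) (opposite i))
proposition4p11 n A↔Fin θ θ-involutive S specular T =
    pathLabels-partition isBiextendable T
  , pathLabels-composable isBiextendable T
  , closedLabels≐evenWords isBiextendable T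
  , inverseSet-pathLabels θ θ-involutive S specular T
  where open IsSpecular specular
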